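{- Suppose $I$ is a set, $(A_i)_{i\in I}$ a family of groups, $C$ a group, and $h:A=\prod_{i\in I} A_i\to C$ a group homomorphism. Then the following conditions are equivalent: (a) For every partition of $I$ into a countably infinite family of subsets $J_m$ ($m\in\omega$), at least one of the subgroups $\prod_{i\in J_m} A_i\subseteq A$ lies in $\ker(h)$. (b) The homomorphism $h$ factors as $A\to A/\mathcal{U}_0\times\dots\times A/\mathcal{U}_{n-1}\to C$ (where the first arrow is the product of the quotient maps) for some finite family of ultrafilters $\mathcal{U}_0,\dots,\mathcal{U}_{n-1}$ on $I$. In this situation, the filter $$\mathcal{F}=\{J\subseteq I\mid \textstyle\prod_{i\in I-J}A_i\subseteq\ker(h)\}$$ is the intersection of the unique least set of ultrafilters that can be used in (b).
   Context: Groups are not assumed abelian. For $J\subseteq I$, $\prod_{i\in J}A_i$ is identified with the subgroup of $A=\prod_{i\in I}A_i$ consisting of the elements $a=(a_i)_{i\in I}$ whose support $\{i\in I\mid a_i\neq e\}$ is contained in $J$. For a filter (in particular, an ultrafilter) $\mathcal{U}$ on $I$, $A/\mathcal{U}$ denotes the reduced product: the quotient of $\prod_{i\in I} A_i$ by the equivalence relation $(a_i)\sim(b_i)$ iff $\{i\mid a_i=b_i\}\in\mathcal{U}$, with the induced group structure. A filter on $I$ is a set of subsets of $I$ containing $I$, closed under passing to larger subsets of $I$, and closed under pairwise intersections; it may be improper (equal to the set of all subsets of $I$). An ultrafilter is a maximal proper filter. The intersection of the empty family of ultrafilters is taken to be the set of all subsets of $I$; finite families may be empty ($n=0$), the empty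 product being the trivial group. A partition of $I$ is an expression of $I$ as the union of an indexed family of pairwise disjoint, possibly empty, subsets. -}

module Defs where

open import Algebra.Bundles using (Group)
open import Algebra.Morphism.Bundles using (GroupHomomorphism)
open import Data.Fin.Base using (Fin)
open import Data.Nat.Base using (ℕ)
open import Data.Product.Base using (∃; ∃-syntax; _×_; _,_)
open import Data.Unit.Polymorphic.Base using (⊤)
open import Function.Base using (_on_)
open import Level using (Level; _⊔_; suc)
open import Relation.Binary.Core using (Rel)
open import Relation.Binary.PropositionalEquality.Core using (_≢_)
open import Relation.Nullary.Negation.Core using (¬_)
open import Relation.Unary
  using (Pred; _∈_; _⊆_; _≐_; _⊥_; ∁; _∩_; ⋃; Universal)

private
  variable
    c r ℓ : Level

infixr 0 _⟶ᴳ_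

_⟶ᴳ_ : Group c r → Group c r → Set (c ⊔ r)
G ⟶ᴳ H = GroupHomomorphism (Group.rawGroup G) (Group.rawGroup H)

∏ : ∀ {i} {I : Set i} → (I → Group c r) → Group (i ⊔ c) (i ⊔ r)
∏ {I = I} A = record
  { Carrier = (i : I) → A.Carrier i
  ; _≈_ = λ a b → ∀ i → A._≈_ i (a i) (b i)
  ; _∙_ = λ a b i → A._∙_ i (a i) (b i)
  ; ε   = λ i → A.ε i
  ; _⁻¹ = λ a i → A._⁻¹ i (a i)
  ; isGroup = record
    { isMonoid = record
      { isSemigroup = record
        { isMagma = record
          { isEquivalence = record
            { refl  = λ i → A.refl i
            ; sym   = λ p i → A.sym i (p i)
            ; trans = λ p q i → A.trans i (p i) (q i)
            }
          ; ∙-cong = λ p q i → A.∙-cong i (p i) (q i)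
          }
        ; assoc = λ a b d i → A.assoc i (a i) (b i) (d i)
        }
      ; identity = (λ a i → A.identityˡ i (a i)) , (λ a i → A.identityʳ i (a i))
      }
    ; inverse = (λ a i → A.inverseˡ i (a i)) , (λ a i → A.inverseʳ i (a i))
    ; ⁻¹-cong = λ p i → A.⁻¹-cong i (p i)
    }
  }
  where module A i = Group (A i)

Subset : Set ℓ → Set (suc ℓ)
Subset {ℓ} I = Pred I ℓ

record IsFilter {I : Set ℓ} (F : Pred (Subset I) ℓ) : Set (suc ℓ) where
  field
    whole  : (λ _ → ⊤) ∈ F
    upward : ∀ {J K} → J ⊆ K → J ∈ F → K ∈ F
    inter  : ∀ {J K} → J ∈ F → K ∈ F → J ∩ K ∈ F

record Filter (I : Set ℓ) : Set (suc ℓ) where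
  field
    members  : Pred (Subset I) ℓ
    isFilter : IsFilter members

  open IsFilter isFilter public

open Filter using (members)

Proper : {I : Set ℓ} → Filter I → Set (suc ℓ)
Proper F = ¬ Universal (members F)

record Ultrafilter (I : Set ℓ) : Set (suc ℓ) where
  field
    filter  : Filter I
    proper  : Proper filter
    maximal : ∀ (G : Filter I) → Proper G →
              members filter ⊆ members G → members G ⊆ members filter

  sets : Pred (Subset I) ℓ
  sets = members filter

open Ultrafilter using (filter; sets)

_≈ᵁ_ : {I : Set ℓ} → Rel (Ultrafilter I) (suc ℓ)
_≈ᵁ_ = _≐_ on sets

-- The equality of a stdlib group is part of its structure, so a quotient
-- keeps the carrier and coarsens the equality.
_/_ : {I : Set ℓ} → (I → Group ℓ ℓ) → Filter I → Group ℓ ℓ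
_/_ {I = I} A F = record
  { Carrier = ΠA.Carrier
  ; _≈_ = λ a b → (λ i → A._≈_ i (a i) (b i)) ∈ F.members
  ; _∙_ = ΠA._∙_
  ; ε   = ΠA.ε
  ; _⁻¹ = ΠA._⁻¹
  ; isGroup = record
    { isMonoid = record
      { isSemigroup = record
        { isMagma = record
          { isEquivalence = record
            { refl  = everywhere ΠA.refl
            ; sym   = F.upward (A.sym _)
            ; trans = λ p q → F.upward (λ (x , y) → A.trans _ x y) (F.inter p q)
            }
          ; ∙-cong = λ p q → F.upward (λ (x , y) → A.∙-cong _ x y) (F.inter p q)
          }
        ; assoc = λ a b d → everywhere (ΠA.assoc a b d)
        }
      ; identity = (λ a → everywhere (ΠA.identityˡ a)) , (λ a → everywhere (ΠA.identityʳ a))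
      }
    ; inverse = (λ a → everywhere (ΠA.inverseˡ a)) , (λ a → everywhere (ΠA.inverseʳ a))
    ; ⁻¹-cong = F.upward (A.⁻¹-cong _)
    }
  }
  where
  module A i = Group (A i)
  module ΠA = Group (∏ A)
  module F = Filter F
  everywhere : ∀ {J : Subset I} → (∀ i → J i) → J ∈ F.members
  everywhere p = F.upward (λ {i} _ → p i) F.whole

quotientMaps : {I : Set ℓ} (A : I → Group ℓ ℓ) {n : ℕ} (𝒰 : Fin n → Filter I) →
               ∏ A ⟶ᴳ ∏ (λ k → A / 𝒰 k)
quotientMaps A 𝒰 = record
  { ⟦_⟧ = λ a k → a
  ; isGroupHomomorphism = record
    { isMonoidHomomorphism = record
      { isMagmaHomomorphism = record
        { isRelHomomorphism = record
          { cong = λ p k → Filter.upward (𝒰 k) (λ {i} _ → p i) (Filter.whole (𝒰 k)) }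
        ; homo = λ a b k → Group.refl (A / 𝒰 k)
        }
      ; ε-homo = λ k → Group.refl (A / 𝒰 k)
      }
    ; ⁻¹-homo = λ a k → Group.refl (A / 𝒰 k)
    }
  }

IsPartition : {I : Set ℓ} → (ℕ → Subset I) → Set ℓ
IsPartition J = (∀ {m n} → m ≢ n → J m ⊥ J n) × Universal (⋃ ℕ J)

supp : {I : Set ℓ} (A : I → Group ℓ ℓ) → Group.Carrier (∏ A) → Subset I
supp A a i = ¬ Group._≈_ (A i) (a i) (Group.ε (A i))

∏[_] : {I : Set ℓ} {A : I → Group ℓ ℓ} → Subset I → Pred (Group.Carrier (∏ A)) ℓ
∏[_] {A = A} J a = supp A a ⊆ J

ker : {G H : Group ℓ ℓ} → (G ⟶ᴳ H) → Pred (Group.Carrier G) ℓ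
ker {H = H} h a = Group._≈_ H (GroupHomomorphism.⟦_⟧ h a) (Group.ε H)

-- Such a predicate need not respect _≈ᵁ_, but every Usable one below does,
-- being extensionally equal to a Range.
UltrafilterSet : Set ℓ → Set (suc (suc ℓ))
UltrafilterSet {ℓ} I = Pred (Ultrafilter I) (suc ℓ)

Range : {I : Set ℓ} {n : ℕ} → (Fin n → Ultrafilter I) → UltrafilterSet I
Range 𝒰 V = ∃[ k ] V ≈ᵁ 𝒰 k

Intersection : {I : Set ℓ} → UltrafilterSet I → Pred (Subset I) (suc ℓ)
Intersection S J = ∀ {V} → V ∈ S → J ∈ sets V

module _ {I : Set ℓ} (A : I → Group ℓ ℓ) (C : Group ℓ ℓ) (h : ∏ A ⟶ᴳ C) where

  private
    module C = Group C
    module h = GroupHomomorphism h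

  KillsPartBlock : Set (suc ℓ)
  KillsPartBlock = ∀ (J : ℕ → Subset I) → IsPartition J →
                   ∃[ m ] ∏[_] {A = A} (J m) ⊆ ker {G = ∏ A} {H = C} h

  FactorsThrough : {n : ℕ} → (Fin n → Ultrafilter I) → Set ℓ
  FactorsThrough 𝒰 =
    ∃ λ (g : ∏ (λ k → A / filter (𝒰 k)) ⟶ᴳ C) →
      ∀ a → h.⟦ a ⟧ C.≈ GroupHomomorphism.⟦_⟧ g (π.⟦ a ⟧)
    where module π = GroupHomomorphism (quotientMaps A (λ k → filter (𝒰 k)))

  FactorsThroughUltraproducts : Set (suc ℓ)
  FactorsThroughUltraproducts =
    ∃[ n ] ∃ λ (𝒰 : Fin n → Ultrafilter I) → FactorsThrough 𝒰

  kernelFilter : Pred (Subset I) ℓ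
  kernelFilter J = ∏[_] {A = A} (∁ J) ⊆ ker {G = ∏ A} {H = C} h

  Usable : UltrafilterSet I → Set (suc ℓ)
  Usable S = ∃[ n ] ∃ λ (𝒰 : Fin n → Ultrafilter I) → S ≐ Range 𝒰 × FactorsThrough 𝒰

  IsLeastUsable : UltrafilterSet I → Set (suc (suc ℓ))
  IsLeastUsable S = Usable S × (∀ T → Usable T → S ⊆ T)

{-# OPTIONS --safe #-}
-- Call a set null if its complement lies in the kernel filter ℱ.  By (a), no
-- sequence of pairwise disjoint sets is everywhere non-null, so subtracting
-- non-null sets is a well-founded process.  Hence every non-null set contains
-- an atom (a non-null set that is not the union of two disjoint non-null sets),
-- and I is, up to a null set, a finite disjoint union of atoms P k.  The sets
-- containing P k up to a null set form an ultrafilter 𝒰 k, and ℱ is the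
-- intersection of the 𝒰 k.  Gluing along the P k shows that h factors through
-- the product of the A/𝒰 k.  Conversely, if h factors through ultrafilters 𝒱 j
-- then ⋂ 𝒱 j ⊆ ℱ ⊆ 𝒰 k, and an ultrafilter containing a finite intersection of
-- ultrafilters is one of them; this gives leastness.
--
-- No axiom of choice beyond excluded middle is needed, since excluded middle is
-- assumed for all types: Dec X decides whether X is inhabited and yields an element.
module Submission where

open import Defs
open import Algebra.Bundles using (Group)
open import Algebra.Morphism.Bundles using (GroupHomomorphism)
open import Algebra.Properties.Group using (x∙y⁻¹≈ε⇒x≈y; x≈y⇒x∙y⁻¹≈ε; ε⁻¹≈ε)
open import Axiom.ExcludedMiddle using (ExcludedMiddle)
open import Data.Empty using (⊥-elim)
open import Data.Fin.Base using (Fin; zero; toℕ)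
open import Data.Fin.Properties using (pigeonhole; <⇒≢; toℕ-injective)
open import Data.Nat.Base using (ℕ; zero; _<_; _≤′_; ≤′-refl; ≤′-step)
open import Data.Nat.Properties using (<-cmp; n<1+n; ≤⇒≤′)
open import Data.Product using (Σ; ∃; ∃-syntax; ∃!; _×_; _,_; proj₁; proj₂; swap)
open import Data.Sum using (_⊎_; inj₁; inj₂)
open import Data.Unit.Polymorphic.Base using (⊤)
open import Data.Vec.Functional using (_∷_; [])
open import Function.Base using (_∘_; id; case_of_)
open import Function.Bundles using (_⇔_; mk⇔)
open import Induction.WellFounded using (Acc; acc; WellFounded)
open import Level using (lift; lower; suc)
open import Relation.Binary.Core using (Rel)
open import Relation.Binary.Definitions using (tri<; tri≈; tri>)
open import Relation.Binary.PropositionalEquality using (_≡_; _≢_; refl; sym; cong; subst)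
open import Relation.Nullary using (¬_; Dec; yes; no; contradiction)
open import Relation.Nullary.Decidable using (map′; decidable-stable)
open import Relation.Unary
  using (Pred; _∈_; _∉_; _⊆_; _≐_; _⊥_; ∁; _∩_; _∪_; _⇒_; ⋃; ⋂; Universal)

open Filter using (members)
open Ultrafilter using (filter; sets)

-- Filters and their restriction to a set.

module _ {ℓ} {I : Set ℓ} where

  infixl 6 _↾_

  -- The filter generated by `F` and `P`. Implication replaces an existential over members of `F`,
  -- which would raise the level.
  _↾_ : Filter I → Subset I → Filter I
  F ↾ P = record
    { members  = λ J → P ⇒ J ∈ members F
    ; isFilter = record
      { whole  = F.upward (λ t _ → t) F.whole
      ; upward = λ J⊆K → F.upward (λ f p → J⊆K (f p))
      ; inter  = λ j k → F.upward (λ (f , g) p → f p , g p) (F.inter j k)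
      }
    }
    where module F = Filter F

  ↾-⊇ : ∀ F {P} → members F ⊆ members (F ↾ P)
  ↾-⊇ F = Filter.upward F (λ j _ → j)

  ↾-self : ∀ F {P} → P ∈ members (F ↾ P)
  ↾-self F = Filter.upward F (λ _ p → p) (Filter.whole F)

  ↾-proper : ∀ F {P} → ∁ P ∉ members F → Proper (F ↾ P)
  ↾-proper F {P} ∁P∉F all = ∁P∉F (Filter.upward F (λ f p → f p p) (all (∁ P)))

  ⋂-∈ : (F : Filter I) {n : ℕ} {J : Fin n → Subset I} →
        (∀ k → J k ∈ members F) → ⋂ (Fin n) J ∈ members F
  ⋂-∈ F {zero}  J∈F = Filter.upward F (λ _ ()) (Filter.whole F)
  ⋂-∈ F {ℕ.suc n} J∈F =
    Filter.upward F (λ where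
      (j , js) zero        → j
      (j , js) (Fin.suc k) → js k)
      (Filter.inter F (J∈F zero) (⋂-∈ F (J∈F ∘ Fin.suc)))

  disjoint-∉ : ∀ {F : Filter I} → Proper F → ∀ {J K} → J ⊥ K →
               J ∈ members F → K ∉ members F
  disjoint-∉ {F} proper J⊥K J∈F K∈F =
    proper λ L → Filter.upward F (λ jk → ⊥-elim (J⊥K jk)) (Filter.inter F J∈F K∈F)

-- Ultrafilters under excluded middle.

module Classical {ℓ} (em : ExcludedMiddle (suc ℓ)) where

  dec : ExcludedMiddle ℓ
  dec = map′ lower lift em

  module _ {I : Set ℓ} where

    -- A proper extension `G` containing some `J` outside `F` would also contain `∁ J`, which is
    -- disjoint from `J`.
    prime⇒ultrafilter : (F : Filter I) → Proper F →
                        (∀ J → J ∈ members F ⊎ ∁ J ∈ members F) → Ultrafilter I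
    prime⇒ultrafilter F proper prime = record
      { filter  = F
      ; proper  = proper
      ; maximal = λ G proper′ F⊆G {J} J∈G → case prime J of λ where
          (inj₁ J∈F)  → J∈F
          (inj₂ ∁J∈F) → contradiction (F⊆G ∁J∈F) (disjoint-∉ {F = G} proper′ (λ (j , ¬j) → ¬j j) J∈G)
      }

    -- If `∁ J` is not in `U`, then `filter U ↾ J` is a proper extension of `U` containing `J`, and
    -- maximality applies.
    ultrafilter-prime : (U : Ultrafilter I) → ∀ J → J ∈ sets U ⊎ ∁ J ∈ sets U
    ultrafilter-prime U J with dec {∁ J ∈ sets U}
    ... | yes ∁J∈U = inj₂ ∁J∈U
    ... | no  ∁J∉U = inj₁ (Ultrafilter.maximal U (filter U ↾ J)
                             (↾-proper (filter U) ∁J∉U) (↾-⊇ (filter U)) (↾-self (filter U)))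

    ⊆⇒≈ᵁ : (U V : Ultrafilter I) → sets U ⊆ sets V → U ≈ᵁ V
    ⊆⇒≈ᵁ U V U⊆V = U⊆V , Ultrafilter.maximal U (filter V) (Ultrafilter.proper V) U⊆V

    ⊈⇒∃ : {F G : Pred (Subset I) ℓ} → ¬ (F ⊆ G) → ∃[ J ] J ∈ F × J ∉ G
    ⊈⇒∃ {F} {G} F⊈G with em {∃[ J ] J ∈ F × J ∉ G}
    ... | yes ∃J = ∃J
    ... | no ¬∃J = ⊥-elim (F⊈G λ J∈F → decidable-stable dec λ J∉G → ¬∃J (_ , J∈F , J∉G))

    -- Otherwise each `𝒱 k` has a member `W k` outside `U`. The union of the `W k` lies in every
    -- `𝒱 k`, hence in `U`, but `U` also contains the intersection of their complements.
    ⋂⊆⇒∃≈ : ∀ {n} (𝒱 : Fin n → Ultrafilter I) (U : Ultrafilter I) →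
            (∀ {J} → (∀ k → J ∈ sets (𝒱 k)) → J ∈ sets U) → ∃[ k ] U ≈ᵁ 𝒱 k
    ⋂⊆⇒∃≈ 𝒱 U ⋂𝒱⊆U with em {∃[ k ] U ≈ᵁ 𝒱 k}
    ... | yes ∃k = ∃k
    ... | no ¬∃k = ⊥-elim (disjoint-∉ {F = filter U} (Ultrafilter.proper U) (λ ((k , w) , ¬w) → ¬w k w)
                     (⋂𝒱⊆U λ k → Filter.upward (filter (𝒱 k)) (k ,_) (W∈𝒱 k))
                     (⋂-∈ (filter U) ∁W∈U))
      where
      witness : ∀ k → ∃[ W ] W ∈ sets (𝒱 k) × W ∉ sets U
      witness k = ⊈⇒∃ λ 𝒱k⊆U → ¬∃k (k , swap (⊆⇒≈ᵁ (𝒱 k) U 𝒱k⊆U))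

      W : _ → Subset I
      W = proj₁ ∘ witness

      W∈𝒱 : ∀ k → W k ∈ sets (𝒱 k)
      W∈𝒱 = proj₁ ∘ proj₂ ∘ witness

      ∁W∈U : ∀ k → ∁ (W k) ∈ sets U
      ∁W∈U k with ultrafilter-prime U (W k)
      ... | inj₁ W∈U  = contradiction W∈U (proj₂ (proj₂ (witness k)))
      ... | inj₂ ∁W∈U = ∁W∈U

    -- If every block belonged to some `𝒱 k`, then two of the first `n + 1` blocks would share an
    -- ultrafilter, although they are disjoint.
    missed-block : ∀ {n} (𝒱 : Fin n → Ultrafilter I) (J : ℕ → Subset I) →
                   (∀ {l m} → l ≢ m → J l ⊥ J m) →
                   ∃[ m ] ∀ k → ∁ (J m) ∈ sets (𝒱 k)
    missed-block 𝒱 J disjoint with dec {∃[ m ] ∀ k → ∁ (J m) ∈ sets (𝒱 k)}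
    ... | yes ∃m = ∃m
    ... | no ¬∃m = ⊥-elim (collision (pigeonhole (n<1+n _) (proj₁ ∘ home ∘ toℕ)))
      where
      home : ∀ m → ∃[ k ] J m ∈ sets (𝒱 k)
      home m with dec {∃[ k ] J m ∈ sets (𝒱 k)}
      ... | yes ∃k = ∃k
      ... | no ¬∃k = contradiction (m , ∁J∈) ¬∃m
        where
        ∁J∈ : ∀ k → ∁ (J m) ∈ sets (𝒱 k)
        ∁J∈ k with ultrafilter-prime (𝒱 k) (J m)
        ... | inj₁ J∈  = contradiction (k , J∈) ¬∃k
        ... | inj₂ ∁J∈ = ∁J∈

      collision : ¬ _
      collision (l , m , l<m , same) =
        disjoint-∉ {F = filter (𝒱 k)} (Ultrafilter.proper (𝒱 k)) (disjoint (<⇒≢ l<m ∘ toℕ-injective))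
          (proj₂ (home (toℕ l)))
          (subst (λ k → J (toℕ m) ∈ sets (𝒱 k)) (sym same) (proj₂ (home (toℕ m))))
        where k = proj₁ (home (toℕ l))

  -- Null sets, atoms and the finite decomposition.

  module Atoms {I : Set ℓ} (F : Filter I)
    (block : ∀ J → IsPartition J → ∃[ m ] ∁ (J m) ∈ members F) where

    private module F = Filter F

    disjoint⇒null : (D : ℕ → Subset I) → (∀ {m n} → m ≢ n → D m ⊥ D n) →
                    ∃[ m ] ∁ (D m) ∈ members F
    disjoint⇒null D disjoint =
        let m , null = block J (J-disjoint , J-covers)
        in m , F.upward (λ ¬j d → ¬j (inj₁ d)) null
      where
      J : ℕ → Subset I
      -- Block 0 absorbs the points outside every `D n`, which turns `D` into a partition; enlarging
      -- a set only makes nullity harder.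
      J m = D m ∪ λ i → m ≡ 0 × ¬ (∃[ n ] i ∈ D n)

      J-disjoint : ∀ {m n} → m ≢ n → J m ⊥ J n
      J-disjoint m≢n (inj₁ d , inj₁ d′) = disjoint m≢n (d , d′)
      J-disjoint m≢n (inj₁ d , inj₂ (_ , ¬d)) = contradiction (_ , d) ¬d
      J-disjoint m≢n (inj₂ (_ , ¬d) , inj₁ d) = contradiction (_ , d) ¬d
      J-disjoint m≢n (inj₂ (refl , _) , inj₂ (refl , _)) = contradiction refl m≢n

      J-covers : Universal (⋃ ℕ J)
      J-covers i with dec {∃[ n ] i ∈ D n}
      ... | yes (n , d) = n , inj₁ d
      ... | no ¬d = 0 , inj₂ (refl , ¬d)

    _≺_ : Rel (Subset I) ℓ
    K ≺ L = K ⊆ L × ∁ (L ∩ ∁ K) ∉ members F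

    -- The successive differences of an infinite descending sequence are pairwise disjoint and
    -- non-null, contrary to `disjoint⇒null`.
    ≺-wellFounded : WellFounded _≺_
    ≺-wellFounded K₀ = decidable-stable em λ ¬acc →
      let open Descent (K₀ , ¬acc)
          m , null = disjoint⇒null D D-disjoint
      in proj₂ (proj₂ (descend (seq m))) null
      where
      Inacc = ∃[ K ] ¬ Acc _≺_ K

      descend : (K : Inacc) → ∃ λ (L : Inacc) → proj₁ L ≺ proj₁ K
      descend (K , ¬acc) with em {∃ λ (L : Inacc) → proj₁ L ≺ K}
      ... | yes ∃L = ∃L
      ... | no ¬∃L = contradiction
        (acc λ L≺K → decidable-stable em λ ¬accL → ¬∃L ((_ , ¬accL) , L≺K)) ¬acc

      module Descent (start : Inacc) where
        seq : ℕ → Inacc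
        seq zero    = start
        seq (ℕ.suc n) = proj₁ (descend (seq n))

        K D : ℕ → Subset I
        K = proj₁ ∘ seq
        D n = K n ∩ ∁ (K (ℕ.suc n))

        antitone : ∀ {m n} → m ≤′ n → K n ⊆ K m
        antitone ≤′-refl           = id
        antitone (≤′-step {n} m≤n) = antitone m≤n ∘ proj₁ (proj₂ (descend (seq n)))

        D-disjoint< : ∀ {m n} → m < n → D m ⊥ D n
        D-disjoint< m<n ((_ , ¬k) , (k , _)) = ¬k (antitone (≤⇒≤′ m<n) k)

        D-disjoint : ∀ {m n} → m ≢ n → D m ⊥ D n
        D-disjoint {m} {n} m≢n with <-cmp m n
        ... | tri< m<n _ _ = D-disjoint< m<n
        ... | tri≈ _ m≡n _ = contradiction m≡n m≢n
        ... | tri> _ _ n<m = D-disjoint< n<m ∘ swap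

    -- Indecomposability is phrased as primeness of `F ↾ P`, the form that `prime⇒ultrafilter`
    -- takes.
    Atom : Pred (Subset I) (suc ℓ)
    Atom P = ∁ P ∉ members F × (∀ J → J ∈ members (F ↾ P) ⊎ ∁ J ∈ members (F ↾ P))

    -- If `J` splits `K` into two non-null pieces, the search continues in `K ∩ J`, which lies below
    -- `K` because the discarded piece is non-null.
    atomic : ∀ {K} → Acc _≺_ K → ∁ K ∉ members F → ∃[ P ] P ⊆ K × Atom P
    atomic {K} (acc rs) K-pos
      with em {∃[ J ] J ∉ members (F ↾ K) × ∁ J ∉ members (F ↾ K)}
    ... | yes (J , J∉ , ∁J∉) =
          let P , P⊆K∩J , atom = atomic (rs K∩J≺K) λ null → ∁J∉ (F.upward (λ ¬kj k j → ¬kj (k , j)) null)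
          in P , proj₁ ∘ P⊆K∩J , atom
      where
      K∩J≺K : (K ∩ J) ≺ K
      K∩J≺K = proj₁ , λ null → J∉
        (F.upward (λ ¬d k → decidable-stable dec λ ¬j → ¬d (k , ¬j ∘ proj₂)) null)
    ... | no unsplit = K , id , K-pos , prime
      where
      prime : ∀ J → J ∈ members (F ↾ K) ⊎ ∁ J ∈ members (F ↾ K)
      prime J with dec {J ∈ members (F ↾ K)} | dec {∁ J ∈ members (F ↾ K)}
      ... | yes J∈ | _       = inj₁ J∈
      ... | no _   | yes ∁J∈ = inj₂ ∁J∈
      ... | no J∉  | no ∁J∉  = contradiction (J , J∉ , ∁J∉) unsplit

    record Decomposition (K : Subset I) : Set (suc ℓ) where
      field
        {size}   : ℕ
        part     : Fin size → Subset I
        part-⊆   : ∀ k → part k ⊆ K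
        atom     : ∀ k → Atom (part k)
        disjoint : ∀ k l {i : I} → i ∈ part k → i ∈ part l → k ≡ l
        covers   : K ⇒ ⋃ (Fin size) part ∈ members F

    -- Splitting off an atom `P` removes a non-null set, so the recursion continues below `K` and
    -- stops at a null remainder. For improper `F` it stops at once, with no atoms.
    decompose : ∀ {K} → Acc _≺_ K → Decomposition K
    decompose {K} (acc rs) with dec {∁ K ∈ members F}
    ... | yes null = record
      { part     = []
      ; part-⊆   = λ ()
      ; atom     = λ ()
      ; disjoint = λ ()
      ; covers   = F.upward (λ ¬k k → contradiction k ¬k) null
      }
    ... | no pos with P , P⊆K , P-atom ← atomic (acc rs) pos = record
      { part     = P ∷ D.part
      ; part-⊆   = λ where
          zero        → P⊆K
          (Fin.suc k) → proj₁ ∘ D.part-⊆ k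
      ; atom     = λ where
          zero        → P-atom
          (Fin.suc k) → D.atom k
      ; disjoint = λ where
          zero        zero        p q → refl
          zero        (Fin.suc l) p q → contradiction p (proj₂ (D.part-⊆ l q))
          (Fin.suc k) zero        p q → contradiction q (proj₂ (D.part-⊆ k p))
          (Fin.suc k) (Fin.suc l) p q → cong Fin.suc (D.disjoint k l p q)
      ; covers   = F.upward cover D.covers
      }
      where
      K∖P≺K : (K ∩ ∁ P) ≺ K
      K∖P≺K = proj₁ , λ null → proj₁ P-atom
        (F.upward (λ ¬d p → ¬d (P⊆K p , λ (_ , ¬p) → ¬p p)) null)

      module D = Decomposition (decompose (rs K∖P≺K))

      cover : (K ∩ ∁ P) ⇒ ⋃ (Fin D.size) D.part ⊆ K ⇒ ⋃ (Fin (ℕ.suc D.size)) (P ∷ D.part)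
      cover {i} f k with dec {i ∈ P}
      ... | yes p = zero , p
      ... | no ¬p = let l , q = f (k , ¬p) in Fin.suc l , q

    -- Abstract because with-abstraction over terms mentioning the unfolded parts is intractable.
    abstract
      decomposition : Decomposition (λ _ → ⊤)
      decomposition = decompose (≺-wellFounded _)

    open Decomposition decomposition public
      using (size; part; disjoint)
      renaming (atom to part-atom; covers to part-covers)

    𝒰 : Fin size → Ultrafilter I
    𝒰 k = prime⇒ultrafilter (F ↾ part k)
            (↾-proper F (proj₁ (part-atom k))) (proj₂ (part-atom k))

    ⊆𝒰 : ∀ k → members F ⊆ sets (𝒰 k)
    ⊆𝒰 k = ↾-⊇ F

    part∈𝒰 : ∀ k → part k ∈ sets (𝒰 k)
    part∈𝒰 k = ↾-self F

    -- Each hypothesis says that `J` contains `part k` up to a null set, and the finitely many parts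
    -- cover `I` up to a null set.
    ⋂𝒰⊆ : ∀ {J} → (∀ k → J ∈ sets (𝒰 k)) → J ∈ members F
    ⋂𝒰⊆ J∈𝒰 = F.upward (λ (f , c) → let k , p = c _ in f k p)
                (F.inter (⋂-∈ F J∈𝒰) part-covers)

  -- The kernel filter, and the implication from (b) to (a).

  module _ {I : Set ℓ} (A : I → Group ℓ ℓ) (C : Group ℓ ℓ) (h : ∏ A ⟶ᴳ C) where

    private
      module A i = Group (A i)
      module C = Group C
      module h = GroupHomomorphism h
      module ΠA = Group (∏ A)

    open import Relation.Binary.Reasoning.Setoid C.setoid

    mask : ∀ {i} {X : Set ℓ} → Dec X → A.Carrier i → A.Carrier i
    mask         (yes _) a = a
    mask {i = i} (no _)  a = A.ε i

    kernelFilter-isFilter : IsFilter (kernelFilter A C h)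
    kernelFilter-isFilter = record
      { whole  = λ supp⊆∅ → C.trans
          (h.⟦⟧-cong λ i → decidable-stable dec λ a≉ε → supp⊆∅ a≉ε _) h.ε-homo
      ; upward = λ J⊆K null supp⊆∁K → null (λ a≉ε → supp⊆∁K a≉ε ∘ J⊆K)
      ; inter  = inter
      }
      where
      inter : ∀ {J K} → J ∈ kernelFilter A C h → K ∈ kernelFilter A C h →
              J ∩ K ∈ kernelFilter A C h
      inter {J} {K} J∈ K∈ {a} supp⊆ = begin
        h.⟦ a ⟧                   ≈⟨ h.⟦⟧-cong split ⟩
        h.⟦ onJ ΠA.∙ offJ ⟧       ≈⟨ h.homo onJ offJ ⟩
        h.⟦ onJ ⟧ C.∙ h.⟦ offJ ⟧  ≈⟨ C.∙-cong (K∈ onJ-supp) (J∈ offJ-supp) ⟩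
        C.ε C.∙ C.ε               ≈⟨ C.identityˡ C.ε ⟩
        C.ε                       ∎
        where
        onJ offJ : ΠA.Carrier
        -- Since `a` is trivial on `J ∩ K`, its restriction to `J` is trivial on `K`, and its
        -- restriction to `∁ J` is trivial on `J`; `h` kills both factors.
        onJ  i = mask (dec {i ∈ J}) (a i)
        offJ i = mask (dec {i ∉ J}) (a i)

        split : a ΠA.≈ (onJ ΠA.∙ offJ)
        split i with dec {i ∈ J} | dec {i ∉ J}
        ... | yes j | yes ¬j = contradiction j ¬j
        ... | yes _ | no _   = A.sym i (A.identityʳ i (a i))
        ... | no _  | yes _  = A.sym i (A.identityˡ i (a i))
        ... | no ¬j | no ¬¬j = contradiction ¬j ¬¬j

        onJ-supp : supp A onJ ⊆ ∁ K
        onJ-supp {i} a≉ε with dec {i ∈ J}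
        ... | yes j = λ k → supp⊆ a≉ε (j , k)
        ... | no _  = contradiction (A.refl i) a≉ε

        offJ-supp : supp A offJ ⊆ ∁ J
        offJ-supp {i} a≉ε with dec {i ∉ J}
        ... | yes ¬j = ¬j
        ... | no _   = contradiction (A.refl i) a≉ε

    kernel : Filter I
    kernel = record { members = kernelFilter A C h ; isFilter = kernelFilter-isFilter }

    -- The quotient of `a` by `b` is supported where they disagree, so it lies in the kernel of `h`.
    agree⇒h-≈ : ∀ {a b} → (λ i → A._≈_ i (a i) (b i)) ∈ kernelFilter A C h → h.⟦ a ⟧ C.≈ h.⟦ b ⟧
    agree⇒h-≈ {a} {b} agree = x∙y⁻¹≈ε⇒x≈y C h.⟦ a ⟧ h.⟦ b ⟧ (begin
      h.⟦ a ⟧ C.∙ h.⟦ b ⟧ C.⁻¹   ≈⟨ C.∙-congˡ (h.⁻¹-homo b) ⟨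
      h.⟦ a ⟧ C.∙ h.⟦ b ΠA.⁻¹ ⟧  ≈⟨ h.homo a (b ΠA.⁻¹) ⟨
      h.⟦ a ΠA.∙ b ΠA.⁻¹ ⟧       ≈⟨ agree (λ {i} ≉ε a≈b → ≉ε (x≈y⇒x∙y⁻¹≈ε (A i) a≈b)) ⟩
      C.ε                        ∎)

    -- An element supported off `J` equals the identity on `J`, so its class in every
    -- `A / filter (𝒱 k)` is trivial.
    factors⇒⋂⊆kernel : ∀ {n} (𝒱 : Fin n → Ultrafilter I) → FactorsThrough A C h 𝒱 →
                       ∀ {J} → (∀ k → J ∈ sets (𝒱 k)) → J ∈ kernelFilter A C h
    factors⇒⋂⊆kernel 𝒱 (g , h≈g∘π) J∈𝒱 {a} supp⊆∁J = begin
      h.⟦ a ⟧            ≈⟨ h≈g∘π a ⟩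
      g.⟦ (λ _ → a) ⟧    ≈⟨ g.⟦⟧-cong (λ k → Filter.upward (filter (𝒱 k))
                              (λ j → decidable-stable dec λ a≉ε → supp⊆∁J a≉ε j) (J∈𝒱 k)) ⟩
      g.⟦ (λ _ → ΠA.ε) ⟧ ≈⟨ g.ε-homo ⟩
      C.ε                ∎
      where module g = GroupHomomorphism g

    factors⇒killsPartBlock : FactorsThroughUltraproducts A C h → KillsPartBlock A C h
    factors⇒killsPartBlock (n , 𝒱 , factors) J (disjoint , _) =
      let m , ∁J∈𝒱 = missed-block 𝒱 J disjoint
      in m , λ supp⊆J → factors⇒⋂⊆kernel 𝒱 factors ∁J∈𝒱 (λ a≉ε ¬j → ¬j (supp⊆J a≉ε))

    -- From (a) to (b) by gluing along the atoms, and leastness.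

    module FromKills (kills : KillsPartBlock A C h) where

      block : ∀ J → IsPartition J → ∃[ m ] ∁ (J m) ∈ kernelFilter A C h
      block J partition =
        let m , killed = kills J partition
        in m , λ supp⊆¬¬J → killed (λ a≉ε → decidable-stable dec (supp⊆¬¬J a≉ε))

      open Atoms kernel block public

      pick : ∀ {i} → Dec (∃[ k ] i ∈ part k) → (Fin size → A.Carrier i) → A.Carrier i
      pick         (yes (k , _)) a = a k
      pick {i = i} (no _)        a = A.ε i

      -- The default `ε` off the parts makes `glue` respect the group operations at every
      -- coordinate.
      glue : (Fin size → ΠA.Carrier) → ΠA.Carrier
      glue a i = pick (dec {∃[ k ] i ∈ part k}) (λ k → a k i)

      glue-on-part : ∀ a {k i} → i ∈ part k → glue a i ≡ a k i
      glue-on-part a {i = i} p with dec {∃[ k ] i ∈ part k}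
      ... | yes (l , q) = cong (λ l → a l i) (disjoint _ _ q p)
      ... | no ¬p = contradiction (_ , p) ¬p

      glue-∙ : ∀ a b → glue (λ k → a k ΠA.∙ b k) ΠA.≈ (glue a ΠA.∙ glue b)
      glue-∙ a b i with dec {∃[ k ] i ∈ part k}
      ... | yes (k , _) = A.refl i
      ... | no _ = A.sym i (A.identityˡ i _)

      glue-ε : glue (λ _ → ΠA.ε) ΠA.≈ ΠA.ε
      glue-ε i with dec {∃[ k ] i ∈ part k}
      ... | yes _ = A.refl i
      ... | no _  = A.refl i

      glue-⁻¹ : ∀ a → glue (λ k → a k ΠA.⁻¹) ΠA.≈ (glue a ΠA.⁻¹)
      glue-⁻¹ a i with dec {∃[ k ] i ∈ part k}
      ... | yes _ = A.refl i
      ... | no _  = A.sym i (ε⁻¹≈ε (A i))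

      ≈-on-parts : ∀ {a b} → (∀ k → part k ⇒ (λ i → A._≈_ i (a i) (b i)) ∈ sets (𝒰 k)) →
                   h.⟦ a ⟧ C.≈ h.⟦ b ⟧
      ≈-on-parts a≈b = agree⇒h-≈ (⋂𝒰⊆ λ k →
        Filter.upward (filter (𝒰 k)) (λ (f , p) → f p)
          (Filter.inter (filter (𝒰 k)) (a≈b k) (part∈𝒰 k)))

      -- The second arrow is `h` composed with `glue`. It respects the quotient equalities, and
      -- gluing the constant family `a` gives back `a` on every part; `≈-on-parts` turns both facts
      -- into equalities in `C`.
      factors : FactorsThrough A C h 𝒰
      factors = record
        { ⟦_⟧ = λ a → h.⟦ glue a ⟧
        ; isGroupHomomorphism = record
          { isMonoidHomomorphism = record
            { isMagmaHomomorphism = record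
              { isRelHomomorphism = record
                { cong = λ {a} {b} a≈b → ≈-on-parts λ k →
                    Filter.upward (filter (𝒰 k)) (λ {i} aᵢ≈bᵢ p →
                      A.trans i (A.reflexive i (glue-on-part a p))
                        (A.trans i aᵢ≈bᵢ (A.reflexive i (sym (glue-on-part b p))))) (a≈b k)
                }
              ; homo = λ a b → C.trans (h.⟦⟧-cong (glue-∙ a b)) (h.homo (glue a) (glue b))
              }
            ; ε-homo = C.trans (h.⟦⟧-cong glue-ε) h.ε-homo
            }
          ; ⁻¹-homo = λ a → C.trans (h.⟦⟧-cong (glue-⁻¹ a)) (h.⁻¹-homo (glue a))
          }
        } , λ a → ≈-on-parts λ k → Filter.upward (filter (𝒰 k))
              (λ {i} _ p → A.reflexive i (sym (glue-on-part (λ _ → a) p))) (Filter.whole (filter (𝒰 k)))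

      range-least : IsLeastUsable A C h (Range 𝒰)
      range-least = (size , 𝒰 , (id , id) , factors) , least
        where
        least : ∀ T → Usable A C h T → Range 𝒰 ⊆ T
        least T (n , 𝒱 , (_ , Range⊆T) , factors𝒱) (k , V⊆𝒰 , 𝒰⊆V) =
          -- The intersection of the `𝒱 j` lies in the kernel filter, hence in `𝒰 k`, so `𝒰 k` is
          -- one of them.
          let j , 𝒰⊆𝒱 , 𝒱⊆𝒰 = ⋂⊆⇒∃≈ 𝒱 (𝒰 k) (⊆𝒰 k ∘ factors⇒⋂⊆kernel 𝒱 factors𝒱)
          in Range⊆T (j , 𝒰⊆𝒱 ∘ V⊆𝒰 , 𝒰⊆V ∘ 𝒱⊆𝒰)

      kernelFilter≐ : kernelFilter A C h ≐ Intersection (Range 𝒰)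
      kernelFilter≐ = (λ J∈ (k , _ , 𝒰⊆V) → 𝒰⊆V (⊆𝒰 k J∈))
                    , (λ J∈ → ⋂𝒰⊆ λ k → J∈ {𝒰 k} (k , id , id))

corollary6 : ∀ {ℓ} → ExcludedMiddle (suc ℓ) →
    (I : Set ℓ) (A : I → Group ℓ ℓ) (C : Group ℓ ℓ) (h : ∏ A ⟶ᴳ C) →
    (KillsPartBlock A C h ⇔ FactorsThroughUltraproducts A C h) ×
    (FactorsThroughUltraproducts A C h →
    IsFilter (kernelFilter A C h) ×
    Σ (∃! _≐_ (IsLeastUsable A C h)) λ (S , _) → kernelFilter A C h ≐ Intersection S)
corollary6 em I A C h =
    mk⇔ (λ kills → _ , 𝒰 kills , factors kills) (factors⇒killsPartBlock A C h)
  , λ factorisation →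
      let kills = factors⇒killsPartBlock A C h factorisation
          usable , least = range-least kills
      in kernelFilter-isFilter A C h
       , (Range (𝒰 kills)
         , (usable , least)
         , λ (usable′ , least′) → least _ usable′ , least′ _ usable)
       , kernelFilter≐ kills
  where
  open Classical em
  open FromKills A C h
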